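{- Let $k\ge 3$ be an integer and let $F$ be a $k$-graph on $m$ vertices which is not layered. Then $$\pi_{\mathrm{co}}(F)\ \ge\ q_{k,m}^{ -q_{k,m}}\ >\ 0,\qquad\text{where}\qquad q_{k,m}=\frac{(k-1)^{m+1}-1}{k-2}.$$
   Context: A $k$-graph is a finite $k$-uniform hypergraph: a finite vertex set $V(F)$ together with a set $E(F)$ of $k$-element subsets of $V(F)$ called edges. A $k$-graph $H$ is $F$-free if it contains no (not necessarily induced) subhypergraph isomorphic to $F$. Layered: for a function $f:V(F)\to\mathbb N$ and $e\in E(F)$, let $f(e)$ denote the multiset $\{f(v):v\in e\}$ (with $k$ elements counted with multiplicity). The function $f$ is a layered function of $F$ if (A1) each edge $e$ has exactly one vertex whose label is the maximum within $e$ (i.e. the maximum of $f(e)$ has multiplicity one); and (A2) if $e,e'\in E(F)$ satisfy $\max f(e)=\max f(e')$, then $f(e)=f(e')$ as multisets. A $k$-graph is layered if it has a layered function. Codegree Turán density: for a $k$-graph $H$ and $S\subseteq V(H)$, $d_H(S)$ is the number of edges of $H$ containing $S$. The minimum codegree $\delta_{\mathrm{co}}(H)$ is the minimum of $d_H(S)$ over all $(k-1)$-subsets $S$ of $V(H)$. The codegree Turán number $\mathrm{ex}_{\mathrm{co}}(n,F)$ is the largest value of $\delta_{\mathrm{co}}(H)$ among all $n$-vertex $F$-free $k$-graphs $H$, and $$\pi_{\mathrm{co}}(F)=\lim_{n\to\infty}\frac{\mathrm{ex}_{\mathrm{co}}(n,F)}{n};$$ it is known that this limit always exists. -}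

module Defs where

open import Data.Fin.Base using (Fin)
open import Data.Fin.Subset using (Subset; inside; outside; ⋃; ⁅_⁆; ∣_∣) renaming (_∈_ to _∈ˢ_)
open import Data.Fin.Subset.Properties using (_∈?_; _⊆?_)
open import Data.Integer.Base using (+_)
open import Data.List.Base using (List; []; _∷_; _++_; map; filter; length; allFin)
open import Data.List.Extrema.Nat using (max; min)
open import Data.List.Membership.Propositional using (_∈_)
open import Data.List.Relation.Binary.Permutation.Propositional using (_↭_)
open import Data.List.Relation.Unary.Unique.Propositional using (Unique)
open import Data.Nat.Base
  using (ℕ; zero; suc; _+_; _*_; _∸_; _^_; _≤_; NonZero; >-nonZero; s≤s; z≤n)
import Data.Nat.Base as ℕ
open import Data.Nat.Divisibility using (_∣_; ∣m∣n⇒∣m+n; m∣m*n; _∣0)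
import Data.Nat.DivMod as ℕ
import Data.Nat.Properties as ℕ
open import Data.Product.Base using (Σ-syntax; ∃; ∃-syntax; _×_; _,_)
open import Data.Rational.Base using (ℚ; 0ℚ; _/_)
import Data.Rational.Base as ℚ
open import Data.Sum.Base using (_⊎_)
import Data.Vec.Base as Vec
open import Function.Base using (_∘_)
open import Function.Bundles using (_⇔_)
open import Function.Definitions using (Injective)
open import Relation.Binary.PropositionalEquality
open import Relation.Nullary.Negation.Core using (¬_)

private
  variable
    k m n : ℕ

record KGraph (k n : ℕ) : Set where
  field
    edges   : List (Subset n)
    uniform : ∀ {e} → e ∈ edges → ∣ e ∣ ≡ k
    unique  : Unique edges

open KGraph public

image : (Fin m → Fin n) → Subset m → Subset n
image {m = m} g e = ⋃ (map (⁅_⁆ ∘ g) (filter (_∈? e) (allFin m)))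

Contains : KGraph k n → KGraph k m → Set
Contains {n = n} {m = m} H F =
  Σ[ g ∈ (Fin m → Fin n) ]
    Injective _≡_ _≡_ g × (∀ {e} → e ∈ edges F → image g e ∈ edges H)

Free : KGraph k m → KGraph k n → Set
Free F H = ¬ Contains H F

-- The multiset f(e), as a list to be compared up to permutation.
labels : (Fin m → ℕ) → Subset m → List ℕ
labels {m = m} f e = map f (filter (_∈? e) (allFin m))

maxLabel : (Fin m → ℕ) → Subset m → ℕ
maxLabel f e = max 0 (labels f e)

record IsLayeredFunction (F : KGraph k m) (f : Fin m → ℕ) : Set where
  field
    uniqueMax : ∀ {e} → e ∈ edges F →
                Σ[ v ∈ Fin m ] (v ∈ˢ e × f v ≡ maxLabel f e) ×
                  (∀ {w} → w ∈ˢ e → f w ≡ maxLabel f e → w ≡ v)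
    sameMax   : ∀ {e e′} → e ∈ edges F → e′ ∈ edges F →
                maxLabel f e ≡ maxLabel f e′ → labels f e ↭ labels f e′

Layered : KGraph k m → Set
Layered F = ∃ (IsLayeredFunction F)

allSubsets : ∀ n → List (Subset n)
allSubsets zero    = Vec.[] ∷ []
allSubsets (suc n) = map (inside Vec.∷_) (allSubsets n) ++ map (outside Vec.∷_) (allSubsets n)

degree : KGraph k n → Subset n → ℕ
degree H S = length (filter (S ⊆?_) (edges H))

-- Every degree of a (k − 1)-set is at most n, so the default value n of the
-- minimum matters only when n < k − 1, where there is no (k − 1)-set.
minCodegree : KGraph k n → ℕ
minCodegree {k} {n} H =
  min n (map (degree H) (filter (λ S → ∣ S ∣ ℕ.≟ k ∸ 1) (allSubsets n)))

IsCodegreeTuranNumber : KGraph k m → ℕ → ℕ → Set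
IsCodegreeTuranNumber {k} F n d =
  (Σ[ H ∈ KGraph k n ] Free F H × minCodegree H ≡ d) ×
  (∀ (H : KGraph k n) → Free F H → minCodegree H ≤ d)

-- Dedekind reals: Lower p means p < x and Upper p means x < p.
record ℝ : Set₁ where
  field
    Lower Upper  : ℚ → Set
    lower-inhab  : ∃ Lower
    upper-inhab  : ∃ Upper
    lower-round  : ∀ {p} → Lower p ⇔ (∃[ q ] p ℚ.< q × Lower q)
    upper-round  : ∀ {q} → Upper q ⇔ (∃[ p ] p ℚ.< q × Upper p)
    disjoint     : ∀ {p} → ¬ (Lower p × Upper p)
    located      : ∀ {p q} → p ℚ.< q → Lower p ⊎ Upper q

open ℝ public

infix 4 _≤ℝ_

_≤ℝ_ : ℚ → ℝ → Set
p ≤ℝ x = ¬ Upper x p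

-- a n → x, where |a n − x| < ε is spelt a n − ε < x < a n + ε. The sequence is
-- indexed by positive n so that division by n is allowed.
_⟶_ : (∀ n → .{{NonZero n}} → ℚ) → ℝ → Set
a ⟶ x = ∀ ε → 0ℚ ℚ.< ε → ∃[ N ] ∀ n → .{{_ : NonZero n}} → N ≤ n →
  Lower x (a n ℚ.- ε) × Upper x (a n ℚ.+ ε)

-- x = π_co(F). A relation, because the limit is not available as a
-- constructive function of F. The first component determines ex uniquely.
IsCodegreeTuranDensity : KGraph k m → ℝ → Set
IsCodegreeTuranDensity F x =
  Σ[ ex ∈ (ℕ → ℕ) ]
    (∀ n → IsCodegreeTuranNumber F n (ex n)) ×
    ((λ n → + ex n / n) ⟶ x)

k∸2-nonZero : 3 ≤ k → NonZero (k ∸ 2)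
k∸2-nonZero k≥3 = >-nonZero (ℕ.m<n⇒0<n∸m k≥3)

q : (k m : ℕ) → 3 ≤ k → ℕ
q k m k≥3 = ℕ._/_ ((k ∸ 1) ^ (m + 1) ∸ 1) (k ∸ 2) {{k∸2-nonZero k≥3}}

private
  d∣b^n∸1 : ∀ d n → d ∣ suc d ^ n ∸ 1
  d∣b^n∸1 d zero    = d ∣0
  d∣b^n∸1 d (suc n) =
    subst (d ∣_) (sym (ℕ.+-∸-comm (d * suc d ^ n) (ℕ.m^n>0 (suc d) n)))
      (∣m∣n⇒∣m+n (d∣b^n∸1 d n) (m∣m*n (suc d ^ n)))

-- The truncated division in q is exact.
q-exact : ∀ k m (k≥3 : 3 ≤ k) → q k m k≥3 * (k ∸ 2) ≡ (k ∸ 1) ^ (m + 1) ∸ 1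
q-exact (suc (suc (suc j))) m (s≤s (s≤s (s≤s z≤n))) = ℕ.m/n*n≡m (d∣b^n∸1 (suc j) (m + 1))

q-nonZero : ∀ k m (k≥3 : 3 ≤ k) → NonZero (q k m k≥3)
q-nonZero k@(suc (suc (suc j))) m k≥3@(s≤s (s≤s (s≤s z≤n))) =
  >-nonZero (ℕ.m≥n⇒m/n>0 {n = suc j} (ℕ.∸-monoˡ-≤ 1
    (subst (suc (suc j) ≤_) (cong (suc (suc j) ^_) (ℕ.+-comm 1 m))
      (ℕ.m≤m*n (suc (suc j)) (suc (suc j) ^ m) {{ℕ.m^n≢0 (suc (suc j)) m}}))))

q^-q : (k m : ℕ) → 3 ≤ k → ℚ
q^-q k m k≥3 =
  _/_ (+ 1) (q k m k≥3 ^ q k m k≥3)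
    {{ℕ.m^n≢0 (q k m k≥3) (q k m k≥3) {{q-nonZero k m k≥3}}}}

-- Let j = k − 1 and s = q k m, the number of nodes of the complete j-ary tree of
-- depth m. Every vertex carries a labelling of this tree by s labels, and each of
-- the s ^ s labellings is carried by the same share of the vertices. A vertex w
-- forms an edge with v₁, …, vⱼ if the subtrees of w at the children of its root are
-- the truncated trees of the vᵢ and its root label occurs nowhere else in its tree.
-- For given vᵢ a suitable tree exists, since s − 1 of the s labels at most are used
-- below the root, so the codegree is at least n / s ^ s.
--
-- If F embeds, join w to the vᵢ for each edge. Partition the m vertices of F into
-- classes whose trees agree up to depth c, the number of classes; initially c = m.
-- As long as two edges with tops in one class have corresponding vertices in
-- different classes, merge these two classes, which costs one level of agreement.
-- When this stops, the graph of classes has no cycle: a cycle has length at most c,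
-- so the root label of a class on it would reappear at that depth in its own tree.
-- An injective labelling of the classes that decreases along the graph is layered.
--
-- The assertion about π is a negation, so double negations can be eliminated.

module Submission where

open import Defs
open import Data.Fin.Base as Fin using (Fin; zero; suc; toℕ; inject₁; punchOut; fromℕ<)
import Data.Fin.Properties as Fin
open import Data.Fin.Subset
  using (Subset; inside; outside; ⋃; ⁅_⁆; ∣_∣; _∪_) renaming (_∈_ to _∈ˢ_; _∉_ to _∉ˢ_)
open import Data.Fin.Subset.Properties
  using (_∈?_; _⊆?_; x∈⁅x⁆; x∈⁅y⁆⇒x≡y; ∉⊥; x∈p∪q⁺; x∈p∪q⁻; p⊆p∪q; drop-there)
open import Data.Integer.Base as ℤ using (+_)
import Data.Integer.Properties as ℤ
open import Data.List.Base using (List; []; _∷_; map; filter; length; allFin; tabulate; lookup)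
open import Data.List.Extrema.Nat using (max≤v⁺; v≤max⁺; v≤min⁺)
open import Data.List.Membership.Propositional using (_∈_)
open import Data.List.Membership.Propositional.Properties
open import Data.List.Membership.Propositional.Properties.WithK using (unique∧set⇒bag)
import Data.List.Membership.Setoid.Properties as Setoid
import Data.List.Properties as List
open import Data.List.Relation.Binary.BagAndSetEquality using (∼bag⇒↭)
open import Data.List.Relation.Binary.Permutation.Propositional
  using (_↭_; ↭-sym; ↭-trans; ↭-reflexive)
import Data.List.Relation.Binary.Permutation.Propositional.Properties as Perm
open Perm using (↭-length; ↭-map-inv; ∈-resp-↭; All-resp-↭)
open import Data.List.Relation.Unary.All as All using ([]; _∷_)
import Data.List.Relation.Unary.All.Properties as All
open import Data.List.Relation.Unary.AllPairs using ([]; _∷_)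
open import Data.List.Relation.Unary.Any as Any using (here; there)
open import Data.List.Relation.Unary.Unique.Propositional using (Unique)
import Data.List.Relation.Unary.Unique.Propositional.Properties as Unique
open import Data.Nat.Base
open import Data.Nat.DivMod
open import Data.Nat.Induction using (<-rec)
open import Data.Nat.Properties
open import Data.Product.Base using (Σ-syntax; ∃; ∃-syntax; _×_; _,_; proj₁; proj₂)
open import Data.Rational.Base as ℚ using (ℚ; 0ℚ) renaming (_<_ to _<ℚ_; _≤_ to _≤ℚ_)
import Data.Rational.Properties as ℚ
open import Algebra.Properties.Group ℚ.+-0-group using (⁻¹-involutive)
open import Data.Rational.Unnormalised.Base as ℚᵘ using (mkℚᵘ)
import Data.Rational.Unnormalised.Properties as ℚᵘ
open import Data.Sum.Base using (_⊎_; inj₁; inj₂; [_,_]′)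
open import Data.Vec.Base as Vec using (here; there)
open import Effect.Monad using (RawMonad)
open import Function.Base using (_∘_; id)
open import Function.Bundles using (Equivalence; mk⇔)
open import Function.Definitions using (Injective)
open import Level using (0ℓ)
open import Relation.Binary.PropositionalEquality
open import Relation.Nullary.Decidable using (Dec; yes; no; ¬¬-excluded-middle; decidable-stable)
open import Relation.Nullary.Negation using (¬_; contradiction; ¬¬-Monad)
open import Relation.Unary using (Decidable)

-- Double negation and merging of classes.

¬¬-least : (P : ℕ → Set) → ∀ l → P l → ¬ ¬ (∃[ l₀ ] P l₀ × (∀ l → P l → l₀ ≤ l))
¬¬-least P = <-rec _ λ l rec Pl none →
  none (l , Pl , λ l′ Pl′ → ≮⇒≥ λ l′<l → rec l′<l Pl′ none)

¬¬-∀-Fin : ∀ {n} {P : Fin n → Set} → (∀ i → ¬ ¬ P i) → ¬ ¬ (∀ i → P i)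
¬¬-∀-Fin = Fin.sequence (RawMonad.rawApplicative (¬¬-Monad {0ℓ}))

-- One instance of excluded middle for each of the finitely many subsets. This supplies the decision
-- of `IsEdge` by which the edge list of `H` is filtered.
¬¬-decidable : ∀ {n} (P : Subset n → Set) → ¬ ¬ (∀ e → Dec (P e))
¬¬-decidable {zero}  P no-dec = ¬¬-excluded-middle λ P? → no-dec λ { Vec.[] → P? }
¬¬-decidable {suc n} P no-dec =
  ¬¬-decidable (P ∘ (inside Vec.∷_)) λ in? →
  ¬¬-decidable (P ∘ (outside Vec.∷_)) λ out? →
  no-dec λ { (inside Vec.∷ e) → in? e ; (outside Vec.∷ e) → out? e }

-- `punchOut` removes `y` from the codomain, and `y` itself goes where `x` goes.
merge : ∀ {c} (x y : Fin (suc c)) → x ≢ y →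
  Σ[ h ∈ (Fin (suc c) → Fin c) ]
    (∀ {z z′} → h z ≡ h z′ → z ≡ z′ ⊎ (z ≡ x × z′ ≡ y) ⊎ (z ≡ y × z′ ≡ x))
merge {c} x y x≢y = h , λ {z} {z′} → separates z z′
  where
  h : Fin (suc c) → Fin c
  h z with y Fin.≟ z
  ... | yes _   = punchOut (x≢y ∘ sym)
  ... | no y≢z = punchOut y≢z

  separates : ∀ z z′ → h z ≡ h z′ → z ≡ z′ ⊎ (z ≡ x × z′ ≡ y) ⊎ (z ≡ y × z′ ≡ x)
  separates z z′ eq with y Fin.≟ z | y Fin.≟ z′
  ... | yes refl | yes refl = inj₁ refl
  ... | yes refl | no  y≢z′ = inj₂ (inj₂ (refl , sym (Fin.punchOut-injective (x≢y ∘ sym) y≢z′ eq)))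
  ... | no  y≢z  | yes refl = inj₂ (inj₁ (Fin.punchOut-injective y≢z (x≢y ∘ sym) eq , refl))
  ... | no  y≢z  | no  y≢z′ = inj₁ (Fin.punchOut-injective y≢z y≢z′ eq)

-- Labelled trees and layerings.

-- The nodes of the complete j-ary tree of depth d are numbered in heap order,
-- 0 being the root.
treeSize : ℕ → ℕ → ℕ
treeSize j zero    = 1
treeSize j (suc d) = suc (j * treeSize j d)

-- If node x of the subtree rooted at child i of the root is counted within that
-- subtree, this is its number in the whole tree.
child : ∀ {j} → Fin j → ℕ → ℕ
child {j} i x = suc (toℕ i + j * x)

child-< : ∀ {j} (i : Fin j) {x s} → x < s → child i x < suc (j * s)
child-< {j} i {x} {s} x<s = s≤s (begin-strict
  toℕ i + j * x <⟨ +-monoˡ-< (j * x) (Fin.toℕ<n i) ⟩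
  j + j * x     ≡⟨ *-suc j x ⟨
  j * suc x     ≤⟨ *-monoʳ-≤ j x<s ⟩
  j * s         ∎)
  where open ≤-Reasoning

0<treeSize : ∀ j d → 0 < treeSize j d
0<treeSize j zero    = z<s
0<treeSize j (suc d) = z<s

treeSize-≤-suc : ∀ j .{{_ : NonZero j}} d → treeSize j d ≤ treeSize j (suc d)
treeSize-≤-suc j d = m≤n⇒m≤1+n (m≤n*m (treeSize j d) j)

treeSize-mono : ∀ j .{{_ : NonZero j}} {d d′} → d ≤ d′ → treeSize j d ≤ treeSize j d′
treeSize-mono j d≤d′ = go (≤⇒≤′ d≤d′)
  where
  go : ∀ {d d′} → d ≤′ d′ → treeSize j d ≤ treeSize j d′
  go ≤′-refl       = ≤-refl
  go (≤′-step d≤′) = ≤-trans (go d≤′) (treeSize-≤-suc j _)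

-- τ is a labelled tree with s nodes whose subtrees at the children of the root
-- are truncations of the trees σ i and whose root label occurs nowhere else.
record Link {j} (s : ℕ) (τ : ℕ → ℕ) (σ : Fin j → ℕ → ℕ) : Set where
  field
    inherits : ∀ i x → child i x < s → τ (child i x) ≡ σ i x
    fresh    : ∀ x → suc x < s → τ (suc x) ≢ τ 0

-- An ordered form of layeredness, with `w` the top of an edge and `v` its other vertices:
-- `descends` will give (A1), and `determines` gives (A2) position by position.
record Layering {V : Set} {j} (L : V → (Fin j → V) → Set) (f : V → ℕ) : Set where
  field
    descends   : ∀ {w v} → L w v → ∀ i → f (v i) < f w
    determines : ∀ {w v w′ v′} → L w v → L w′ v′ → f w ≡ f w′ → ∀ i → f (v i) ≡ f (v′ i)

-- Trees on the vertices yield a layering.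

module _ {m j : ℕ} .{{_ : NonZero j}} (T : Fin m → ℕ → ℕ) where

  private
    L : Fin m → (Fin j → Fin m) → Set
    L w v = Link (treeSize j m) (T w) (T ∘ v)

    child-<′ : ∀ (i : Fin j) {x d d′} → x < treeSize j d → d < d′ → child i x < treeSize j d′
    child-<′ i x< d<d′ = <-≤-trans (child-< i x<) (treeSize-mono j d<d′)

  Agree : ∀ {c} → (Fin m → Fin c) → Set
  Agree {c} cls = ∀ {u v} → cls u ≡ cls v → ∀ x → x < treeSize j c → T u x ≡ T v x

  module _ {c : ℕ} (c≤m : c ≤ m) (cls : Fin m → Fin c) (agree : Agree cls) where

    Step : Fin c → Fin c → Set
    Step C D = Σ[ w ∈ Fin m ] Σ[ v ∈ (Fin j → Fin m) ] Σ[ i ∈ Fin j ]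
      L w v × cls w ≡ C × cls (v i) ≡ D

    IsWalk : ∀ {l} → (Fin (suc l) → Fin c) → Set
    IsWalk p = ∀ i → Step (p (inject₁ i)) (p (suc i))

    -- Each step matches a subtree of the upper vertex with the tree of the lower one, so the root
    -- labels met along the walk lie one level deeper per step. Vertices of one class may be
    -- exchanged, since these depths stay within `l ≤ c`.
    descent : ∀ {l} (p : Fin (suc l) → Fin c) → IsWalk p → l ≤ c → ∀ i {u v} →
      cls u ≡ p zero → cls v ≡ p (suc i) →
      ∃[ x ] suc x < treeSize j (suc (toℕ i)) × T u (suc x) ≡ T v 0
    descent {suc l} p walk l≤c i {u} {v} u∈ v∈ with walk zero
    ... | w , v′ , y , link , w∈ , v′∈ = go i v∈
      where
      module link = Link link

      pass : ∀ x → child y x < treeSize j c → T u (child y x) ≡ T (v′ y) x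
      pass x x< = trans (agree (trans u∈ (sym w∈)) _ x<)
        (link.inherits y x (<-≤-trans x< (treeSize-mono j c≤m)))

      go : ∀ i → cls v ≡ p (suc i) →
        ∃[ x ] suc x < treeSize j (suc (toℕ i)) × T u (suc x) ≡ T v 0
      go zero v∈ = _ , child-< y z<s ,
        trans (pass 0 (child-<′ y {d = 0} z<s (≤-trans (s≤s z≤n) l≤c)))
              (agree (trans v′∈ (sym v∈)) 0 (0<treeSize j c))
      go (suc i) v∈
        with x , x< , eq ← descent (p ∘ suc) (walk ∘ suc) (≤-trans (n≤1+n l) l≤c) i v′∈ v∈ =
        _ , child-< y x< ,
        trans (pass (suc x) (child-<′ y x< (≤-trans (s≤s (Fin.toℕ<n i)) l≤c))) eq

    -- If a class recurs, `descent` with one vertex of it as both start and end finds the root label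
    -- again below the root, against `fresh`.
    walk-injective : ∀ {l} (p : Fin (suc l) → Fin c) → IsWalk p → l ≤ c →
      ∀ i k → i Fin.< k → p i ≢ p k
    walk-injective {suc l} p walk l≤c zero (suc k) _ eq with walk zero
    ... | w , v , y , link , w∈ , v∈
      with x , x< , Tx≡T0 ← descent p walk l≤c k w∈ (trans w∈ eq) =
      Link.fresh link x
        (<-≤-trans x< (treeSize-mono j (≤-trans (≤-trans (Fin.toℕ<n k) l≤c) c≤m))) Tx≡T0
    walk-injective {suc l} p walk l≤c (suc i) (suc k) (s<s i<k) =
      walk-injective (p ∘ suc) (walk ∘ suc) (≤-trans (n≤1+n l) l≤c) i k i<k

    WalkFrom : ℕ → Fin c → Set
    WalkFrom l C = Σ[ p ∈ (Fin (suc l) → Fin c) ] p zero ≡ C × IsWalk p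

    walk-bounded : ∀ C → ¬ WalkFrom c C
    walk-bounded C (p , _ , walk) with i , k , i<k , eq ← Fin.pigeonhole (n<1+n c) p =
      walk-injective p walk ≤-refl i k i<k eq

    walk-extend : ∀ {l C D} → Step C D → WalkFrom l D → WalkFrom (suc l) C
    walk-extend {l} {C} step (p , refl , walk) = p′ , refl , λ { zero → step ; (suc i) → walk i }
      where
      p′ : Fin (suc (suc l)) → Fin c
      p′ zero    = C
      p′ (suc i) = p i

    IsHeight : (Fin c → ℕ) → Set
    IsHeight h = ∀ {C D} → Step C D → h D < h C

    -- The height of `C` is the least length for which no walk starts at `C`.
    ¬¬-height : ¬ ¬ (∃ IsHeight)
    ¬¬-height none = ¬¬-∀-Fin (λ C → ¬¬-least (λ l → ¬ WalkFrom l C) c (walk-bounded C)) λ least →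
      none (proj₁ ∘ least , decreases least)
      where
      decreases : (least : ∀ C → ∃[ l ] ¬ WalkFrom l C × (∀ l′ → ¬ WalkFrom l′ C → l ≤ l′)) →
        IsHeight (proj₁ ∘ least)
      decreases least {C} {D} step with least C
      ... | zero  , ¬walk , _ = contradiction ((λ _ → C) , refl , λ ()) ¬walk
      -- A walk of length `l` from `D` would extend to one of length `suc l` from `C`, so the height
      -- of `D` is at most `l`.
      ... | suc l , ¬walk , _ = s≤s (proj₂ (proj₂ (least D)) l (¬walk ∘ walk-extend step))

    height⇒layering :
      (∀ {w v w′ v′} → L w v → L w′ v′ → cls w ≡ cls w′ → ∀ i → cls (v i) ≡ cls (v′ i)) →
      ∃ IsHeight → ∃ (Layering L)
    height⇒layering consistent (h , h-decr) = f , record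
      { descends   = λ {w} {v} link i → code-< (h-decr (w , v , i , link , refl , refl))
      ; determines = λ link link′ eq i → cong code (consistent link link′ (code-injective eq) i)
      }
      where
      -- The height as leading part makes the code decrease along steps; the class number as last
      -- digit in base `c` makes it injective.
      code : Fin c → ℕ
      code C = toℕ C + h C * c

      f : Fin m → ℕ
      f = code ∘ cls

      code-< : ∀ {C D} → h D < h C → code D < code C
      code-< {C} {D} hD<hC = begin-strict
        toℕ D + h D * c <⟨ +-monoˡ-< (h D * c) (Fin.toℕ<n D) ⟩
        suc (h D) * c   ≤⟨ *-monoˡ-≤ c hD<hC ⟩
        h C * c         ≤⟨ m≤n+m (h C * c) (toℕ C) ⟩
        code C          ∎
        where open ≤-Reasoning

      code-%c : ∀ C .{{_ : NonZero c}} → code C % c ≡ toℕ C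
      code-%c C = trans ([m+kn]%n≡m%n (toℕ C) (h C) c) (m<n⇒m%n≡m (Fin.toℕ<n C))

      code-injective : ∀ {C D} → code C ≡ code D → C ≡ D
      code-injective {C} {D} eq = Fin.toℕ-injective
        (trans (sym (code-%c C)) (trans (cong (_% c) eq) (code-%c D)))
        where instance _ = Fin.nonZeroIndex C

  Inconsistent : ∀ {c} → (Fin m → Fin c) → Set
  Inconsistent cls = Σ[ w ∈ Fin m ] Σ[ w′ ∈ Fin m ]
    Σ[ v ∈ (Fin j → Fin m) ] Σ[ v′ ∈ (Fin j → Fin m) ] Σ[ i ∈ Fin j ]
    L w v × L w′ v′ × cls w ≡ cls w′ × cls (v i) ≢ cls (v′ i)

  -- Through the trees of `w` and `w′`, the trees of `v i` and `v′ i` agree to one level less than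
  -- `c`. Merging their classes therefore preserves `Agree` with one class fewer, and the mutual
  -- recursion descends on `c`.
  inconsistent⇒layering : ∀ c → c ≤ m → (cls : Fin m → Fin c) → Agree cls →
    ∀ {w w′ v v′} → L w v → L w′ v′ → cls w ≡ cls w′ →
    ∀ i → cls (v i) ≢ cls (v′ i) → ¬ ¬ (∃ (Layering L))

  classes⇒layering : ∀ c → c ≤ m → (cls : Fin m → Fin c) → Agree cls → ¬ ¬ (∃ (Layering L))
  classes⇒layering c c≤m cls agree none = ¬¬-excluded-middle {A = Inconsistent cls} λ where
    (no consistent) → ¬¬-height c≤m cls agree (none ∘ height⇒layering c≤m cls agree
      λ {w} {v} {w′} {v′} link link′ eq i → decidable-stable (_ Fin.≟ _) λ neq →
        consistent (w , w′ , v , v′ , i , link , link′ , eq , neq))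
    (yes (_ , _ , _ , _ , i , link , link′ , eq , neq)) →
      inconsistent⇒layering c c≤m cls agree link link′ eq i neq none

  inconsistent⇒layering zero    c≤m cls agree {w} = contradiction (cls w) λ ()
  inconsistent⇒layering (suc c) c≤m cls agree {w} {w′} {v} {v′} link link′ eq i neq
    with h , separates ← merge _ _ neq =
    classes⇒layering c (≤-trans (n≤1+n c) c≤m) (h ∘ cls) agree′
    where
    same : ∀ x → x < treeSize j c → T (v i) x ≡ T (v′ i) x
    same x x< = begin
      T (v i) x        ≡⟨ Link.inherits link i x (child-<′ i x< c≤m) ⟨
      T w (child i x)  ≡⟨ agree eq _ (child-< i x<) ⟩
      T w′ (child i x) ≡⟨ Link.inherits link′ i x (child-<′ i x< c≤m) ⟩
      T (v′ i) x       ∎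
      where open ≡-Reasoning

    agree′ : Agree (h ∘ cls)
    agree′ u≈u′ x x< with x<′ ← <-≤-trans x< (treeSize-≤-suc j c) | separates u≈u′
    ... | inj₁ u≡u′ = agree u≡u′ x x<′
    ... | inj₂ (inj₁ (u≡ , u′≡)) =
      trans (agree u≡ x x<′) (trans (same x x<) (sym (agree u′≡ x x<′)))
    ... | inj₂ (inj₂ (u≡ , u′≡)) =
      trans (agree u≡ x x<′) (trans (sym (same x x<)) (sym (agree u′≡ x x<′)))

  ¬¬-layering : ¬ ¬ (∃ (Layering L))
  ¬¬-layering = classes⇒layering m ≤-refl id λ { refl _ _ → refl }

-- Labellings as digit expansions.

digit : (b : ℕ) .{{_ : NonZero b}} → ℕ → ℕ → ℕ
digit b x zero    = x % b
digit b x (suc i) = digit b (x / b) i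

digit-< : ∀ b .{{_ : NonZero b}} x i → digit b x i < b
digit-< b x zero    = m%n<n x b
digit-< b x (suc i) = digit-< b (x / b) i

-- g 0 is the lowest digit, and a is what stands above the l digits.
fromDigits : (b : ℕ) → (ℕ → ℕ) → ℕ → ℕ → ℕ
fromDigits b g zero    a = a
fromDigits b g (suc l) a = g 0 + fromDigits b (g ∘ suc) l a * b

fromDigits-injective : ∀ b .{{_ : NonZero b}} g l {a a′} →
  fromDigits b g l a ≡ fromDigits b g l a′ → a ≡ a′
fromDigits-injective b g zero    eq = eq
fromDigits-injective b g (suc l) eq =
  fromDigits-injective b (g ∘ suc) l (*-cancelʳ-≡ _ _ b (+-cancelˡ-≡ (g 0) _ _ eq))

module _ (b : ℕ) .{{_ : NonZero b}} where

  digit-fromDigits : ∀ g → (∀ i → g i < b) → ∀ l a {i} → i < l →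
    digit b (fromDigits b g l a) i ≡ g i
  digit-fromDigits g g<b (suc l) a {zero}  _ =
    trans ([m+kn]%n≡m%n (g 0) (fromDigits b (g ∘ suc) l a) b) (m<n⇒m%n≡m (g<b 0))
  digit-fromDigits g g<b (suc l) a {suc i} (s<s i<l) =
    trans (cong (λ x → digit b x i) quotient)
          (digit-fromDigits (g ∘ suc) (g<b ∘ suc) l a i<l)
    where
    open ≡-Reasoning
    higher = fromDigits b (g ∘ suc) l a

    no-carry : g 0 % b + higher * b % b < b
    no-carry = subst (_< b) (sym (trans
      (cong₂ _+_ (m<n⇒m%n≡m (g<b 0)) (m*n%n≡0 higher b)) (+-identityʳ (g 0)))) (g<b 0)

    quotient : (g 0 + higher * b) / b ≡ higher
    quotient = begin
      (g 0 + higher * b) / b       ≡⟨ +-distrib-/ (g 0) (higher * b) no-carry ⟩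
      g 0 / b + higher * b / b     ≡⟨ cong₂ _+_ (m<n⇒m/n≡0 (g<b 0)) (m*n/n≡m higher b) ⟩
      higher                       ∎

  fromDigits-< : ∀ g → (∀ i → g i < b) → ∀ l {a n} → a < n → fromDigits b g l a < b ^ l * n
  fromDigits-< g g<b zero    {a} {n} a<n = subst (a <_) (sym (*-identityˡ n)) a<n
  fromDigits-< g g<b (suc l) {a} {n} a<n = begin-strict
    g 0 + fromDigits b (g ∘ suc) l a * b   <⟨ +-monoˡ-< _ (g<b 0) ⟩
    suc (fromDigits b (g ∘ suc) l a) * b
      ≤⟨ *-monoˡ-≤ b (fromDigits-< (g ∘ suc) (g<b ∘ suc) l a<n) ⟩
    b ^ l * n * b                          ≡⟨ *-comm (b ^ l * n) b ⟩
    b * (b ^ l * n)                        ≡⟨ *-assoc b (b ^ l) n ⟨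
    b * b ^ l * n                          ∎
    where open ≤-Reasoning

-- Otherwise a choice of preimages would inject `suc l` values into `l` arguments.
unused-value : ∀ (g : ℕ → ℕ) l → ∃[ y ] y < suc l × (∀ x → x < l → g x ≢ y)
unused-value g l =
  let y , unused = Fin.¬∀⟶∃¬ (suc l) Used used? λ used →
        <-irrefl refl (Fin.injective⇒≤ (proj₁∘used-injective used))
  in toℕ y , Fin.toℕ<n y , λ x x<l eq →
    unused (fromℕ< x<l , trans (cong g (Fin.toℕ-fromℕ< x<l)) eq)
  where
  Used : Fin (suc l) → Set
  Used y = Σ[ x ∈ Fin l ] g (toℕ x) ≡ toℕ y

  used? : ∀ y → Dec (Used y)
  used? y = Fin.any? λ x → g (toℕ x) ≟ toℕ y

  proj₁∘used-injective : (used : ∀ y → Used y) →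
    ∀ {y y′} → proj₁ (used y) ≡ proj₁ (used y′) → y ≡ y′
  proj₁∘used-injective used {y} {y′} eq = Fin.toℕ-injective
    (trans (sym (proj₂ (used y))) (trans (cong (g ∘ toℕ) eq) (proj₂ (used y′))))

-- Division with remainder inverts `child`: node `suc r` is number `r / j` in the subtree at child
-- `r mod j`.
graft : ∀ {j} .{{_ : NonZero j}} → ℕ → (Fin j → ℕ → ℕ) → ℕ → ℕ
graft {j} y σ zero    = y
graft {j} y σ (suc r) = σ (r mod j) (r / j)

graft-child : ∀ {j} .{{_ : NonZero j}} y (σ : Fin j → ℕ → ℕ) i x → graft y σ (child i x) ≡ σ i x
graft-child {j} y σ i x = cong₂ σ
  (Fin.toℕ-injective (trans (Fin.toℕ-fromℕ< _) remainder)) quotient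
  where
  remainder : (toℕ i + j * x) % j ≡ toℕ i
  remainder = trans (cong (λ z → (toℕ i + z) % j) (*-comm j x))
    (trans ([m+kn]%n≡m%n (toℕ i) x j) (m<n⇒m%n≡m (Fin.toℕ<n i)))
  quotient : (toℕ i + j * x) / j ≡ x
  quotient = *-cancelʳ-≡ _ _ j (+-cancelˡ-≡ (toℕ i) _ _ (begin
    toℕ i + r / j * j ≡⟨ cong (_+ r / j * j) remainder ⟨
    r % j + r / j * j ≡⟨ m≡m%n+[m/n]*n r j ⟨
    toℕ i + j * x     ≡⟨ cong (λ z → toℕ i + z) (*-comm j x) ⟩
    toℕ i + x * j     ∎))
    where
    open ≡-Reasoning
    r = toℕ i + j * x

link-extension : ∀ {j} .{{_ : NonZero j}} s .{{_ : NonZero s}} (σ : Fin j → ℕ → ℕ) →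
  (∀ i x → σ i x < s) →
  Σ[ w ∈ (ℕ → ℕ) ] (∀ {a a′} → w a ≡ w a′ → a ≡ a′) × (∀ {a t} → a < t → w a < s ^ s * t) ×
    (∀ a → Link s (digit s (w a)) σ)
-- The root label `0` is a placeholder: only the `l` nodes below the root are inspected, one fewer
-- than there are labels.
link-extension {j} s@(suc l) σ σ<s with y , y<s , unused ← unused-value (graft 0 σ ∘ suc) l =
  fromDigits s g s , fromDigits-injective s g s , fromDigits-< s g g<s s , λ a → record
    { inherits = λ i x x< → trans (digit-fromDigits s g g<s s a x<) (graft-child y σ i x)
    ; fresh    = λ { x x<@(s<s x<l) eq → unused x x<l
        (trans (sym (digit-fromDigits s g g<s s a x<))
               (trans eq (digit-fromDigits s g g<s s a z<s))) }
    }
  where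
  g : ℕ → ℕ
  g = graft y σ
  g<s : ∀ i → g i < s
  g<s zero    = y<s
  g<s (suc i) = σ<s (i mod j) (i / j)

-- Subsets and the lists of their elements.

elements : ∀ {n} → Subset n → List (Fin n)
elements {n} e = filter (_∈? e) (allFin n)

∈-elements⁺ : ∀ {n} {e : Subset n} {x} → x ∈ˢ e → x ∈ elements e
∈-elements⁺ {e = e} x∈e = ∈-filter⁺ (_∈? e) (∈-allFin _) x∈e

∈-elements⁻ : ∀ {n} {e : Subset n} {x} → x ∈ elements e → x ∈ˢ e
∈-elements⁻ {e = e} x∈ = proj₂ (∈-filter⁻ (_∈? e) {xs = allFin _} x∈)

elements-unique : ∀ {n} (e : Subset n) → Unique (elements e)
elements-unique e = Unique.filter⁺ (_∈? e) (Unique.allFin⁺ _)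

-- Stated for general `f` and `P` because the tail of `allFin` is no `allFin` but a `tabulate suc`.
length-filter-tabulate : ∀ {A : Set} {n} {P : A → Set}
  (P? : Decidable P) (f : Fin n → A) (e : Subset n) →
  (∀ {i} → i ∈ˢ e → P (f i)) → (∀ {i} → P (f i) → i ∈ˢ e) →
  length (filter P? (tabulate f)) ≡ ∣ e ∣
length-filter-tabulate P? f Vec.[] from to = refl
length-filter-tabulate P? f (inside Vec.∷ e) from to =
  trans (cong length (List.filter-accept P? (from here)))
    (cong suc (length-filter-tabulate P? (f ∘ suc) e (from ∘ there) (drop-there ∘ to)))
length-filter-tabulate P? f (outside Vec.∷ e) from to =
  trans (cong length (List.filter-reject P? (λ p → contradiction (to p) λ ())))
    (length-filter-tabulate P? (f ∘ suc) e (from ∘ there) (drop-there ∘ to))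

length-elements : ∀ {n} (e : Subset n) → length (elements e) ≡ ∣ e ∣
length-elements e = length-filter-tabulate (_∈? e) id e id id

↭-elements : ∀ {n} {e : Subset n} {xs} → Unique xs →
  (∀ {x} → x ∈ xs → x ∈ˢ e) → (∀ {x} → x ∈ˢ e → x ∈ xs) → xs ↭ elements e
↭-elements {e = e} xs! sound complete = ∼bag⇒↭ (unique∧set⇒bag xs! (elements-unique e)
  (mk⇔ (∈-elements⁺ ∘ sound) (complete ∘ ∈-elements⁻)))

∈-⋃⁻ : ∀ {A : Set} {n} {f : A → Fin n} xs {y} → y ∈ˢ ⋃ (map (⁅_⁆ ∘ f) xs) → ∃[ x ] x ∈ xs × y ≡ f x
∈-⋃⁻ [] y∈ = contradiction y∈ ∉⊥
∈-⋃⁻ {f = f} (x ∷ xs) y∈ with x∈p∪q⁻ ⁅ f x ⁆ _ y∈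
... | inj₁ y∈x = x , here refl , x∈⁅y⁆⇒x≡y _ y∈x
... | inj₂ y∈xs with x′ , x′∈ , eq ← ∈-⋃⁻ xs y∈xs = x′ , there x′∈ , eq

∈-⋃⁺ : ∀ {A : Set} {n} {f : A → Fin n} {xs x} → x ∈ xs → f x ∈ˢ ⋃ (map (⁅_⁆ ∘ f) xs)
∈-⋃⁺ {f = f} (here refl) = x∈p∪q⁺ (inj₁ (x∈⁅x⁆ (f _)))
∈-⋃⁺         (there x∈)  = x∈p∪q⁺ (inj₂ (∈-⋃⁺ x∈))

elements-image : ∀ {m n} {g : Fin m → Fin n} → Injective _≡_ _≡_ g → ∀ e →
  map g (elements e) ↭ elements (image g e)
elements-image {g = g} g-inj e = ↭-elements (Unique.map⁺ g-inj (elements-unique e))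
  (λ y∈ → let x , x∈ , eq = ∈-map⁻ g y∈ in
    subst (_∈ˢ image g e) (sym eq) (∈-⋃⁺ x∈))
  (λ y∈ → let x , x∈ , eq = ∈-⋃⁻ (elements e) y∈ in
    subst (_∈ map g (elements e)) (sym eq) (∈-map⁺ g x∈))

elements-∪⁅⁆ : ∀ {n} {S : Subset n} {w} → w ∉ˢ S → w ∷ elements S ↭ elements (S ∪ ⁅ w ⁆)
elements-∪⁅⁆ {S = S} {w} w∉S = ↭-elements
  (All.¬Any⇒All¬ _ (w∉S ∘ ∈-elements⁻) ∷ elements-unique S)
  (λ { (here refl) → x∈p∪q⁺ (inj₂ (x∈⁅x⁆ w)) ; (there x∈) → x∈p∪q⁺ (inj₁ (∈-elements⁻ x∈)) })
  (λ x∈ → [ there ∘ ∈-elements⁺ , here ∘ x∈⁅y⁆⇒x≡y w ]′ (x∈p∪q⁻ S ⁅ w ⁆ x∈))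

∈-allSubsets : ∀ {n} (e : Subset n) → e ∈ allSubsets n
∈-allSubsets Vec.[] = here refl
∈-allSubsets (inside  Vec.∷ e) = ∈-++⁺ˡ (∈-map⁺ (inside Vec.∷_) (∈-allSubsets e))
∈-allSubsets (outside Vec.∷ e) = ∈-++⁺ʳ _ (∈-map⁺ (outside Vec.∷_) (∈-allSubsets e))

allSubsets-unique : ∀ n → Unique (allSubsets n)
allSubsets-unique zero    = [] ∷ []
allSubsets-unique (suc n) = Unique.++⁺
  (Unique.map⁺ (λ { refl → refl }) (allSubsets-unique n))
  (Unique.map⁺ (λ { refl → refl }) (allSubsets-unique n))
  λ { (e∈ , e∈′) → disjoint-heads (∈-map⁻ _ e∈) (∈-map⁻ _ e∈′) }
  where
  disjoint-heads : ∀ {e} → ∃[ d ] d ∈ allSubsets n × e ≡ inside Vec.∷ d →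
    ¬ (∃[ d ] d ∈ allSubsets n × e ≡ outside Vec.∷ d)
  disjoint-heads (_ , _ , refl) (_ , _ , ())

as-tabulate : ∀ {A : Set} {l} (xs : List A) → length xs ≡ l → Σ[ f ∈ (Fin l → A) ] tabulate f ≡ xs
as-tabulate xs refl = lookup xs , List.tabulate-lookup xs

tabulate-injective : ∀ {A : Set} {l} {f g : Fin l → A} → tabulate f ≡ tabulate g → ∀ i → f i ≡ g i
tabulate-injective eq zero    = List.∷-injectiveˡ eq
tabulate-injective eq (suc i) = tabulate-injective (List.∷-injectiveʳ eq) i

-- As a permutation of `elements e`, the list also has distinct entries.
Enumerates : ∀ {n j} → Fin n → (Fin j → Fin n) → Subset n → Set
Enumerates w v e = w ∷ tabulate v ↭ elements e

enumerates-∣∣ : ∀ {n j} {w} {v : Fin j → Fin n} {e} → Enumerates w v e → ∣ e ∣ ≡ suc j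
enumerates-∣∣ {v = v} {e} enum = trans (sym (length-elements e))
  (trans (sym (↭-length enum)) (cong suc (List.length-tabulate v)))

-- By `elements-image` the enumeration permutes a list of the form `map g`, so it lifts along `g`.
-- This pulls an edge of `H` back to an edge of `F`.
enumerates-image⁻ : ∀ {m n j} {g : Fin m → Fin n} → Injective _≡_ _≡_ g →
  ∀ {e w} {v : Fin j → Fin n} → Enumerates w v (image g e) →
  Σ[ a ∈ Fin m ] Σ[ b ∈ (Fin j → Fin m) ] Enumerates a b e × w ≡ g a × (∀ i → v i ≡ g (b i))
enumerates-image⁻ {g = g} g-inj {e} {w} {v} enum
  with ↭-map-inv g (↭-trans (elements-image g-inj e) (↭-sym enum))
... | a ∷ bs , eq , perm
  with b , refl ← as-tabulate bs (trans (sym (List.length-map g bs))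
         (trans (cong length (sym (List.∷-injectiveʳ eq))) (List.length-tabulate v))) =
  a , b , ↭-sym perm , List.∷-injectiveˡ eq ,
  tabulate-injective (trans (List.∷-injectiveʳ eq) (List.map-tabulate b g))

-- From layerings to layered functions.

module _ {k m j} {F : KGraph k m} {L : Fin m → (Fin j → Fin m) → Set} {f}
  (layering : Layering L f)
  (enumerated : ∀ {e} → e ∈ edges F →
    Σ[ w ∈ Fin m ] Σ[ v ∈ (Fin j → Fin m) ] Enumerates w v e × L w v)
  where

  private
    module layering = Layering layering

    maxLabel-enumerated : ∀ {w v e} → Enumerates w v e → L w v → maxLabel f e ≡ f w
    maxLabel-enumerated {w} {v} {e} enum link = ≤-antisym
      (max≤v⁺ z≤n (All.map⁺ (All-resp-↭ enum
        (≤-refl ∷ All.tabulate⁺ λ i → <⇒≤ (layering.descends link i)))))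
      (v≤max⁺ 0 (labels f e) (inj₂ (Any.map ≤-reflexive (∈-map⁺ f (∈-resp-↭ enum (here refl))))))

    labels-enumerated : ∀ {w} {v : Fin j → Fin m} {e} →
      Enumerates w v e → labels f e ↭ f w ∷ tabulate (f ∘ v)
    labels-enumerated {w} {v} enum = ↭-trans (Perm.map⁺ f (↭-sym enum))
      (↭-reflexive (cong (f w ∷_) (List.map-tabulate v f)))

  -- The label of the top exceeds all others in its edge, so it is the maximum and is attained once.
  layering⇒layered : IsLayeredFunction F f
  layering⇒layered = record { uniqueMax = uniqueMax ; sameMax = sameMax }
    where
    uniqueMax : ∀ {e} → e ∈ edges F →
      Σ[ v ∈ Fin m ] (v ∈ˢ e × f v ≡ maxLabel f e) × (∀ {w} → w ∈ˢ e → f w ≡ maxLabel f e → w ≡ v)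
    uniqueMax {e} e∈
      with w , v , enum , link ← enumerated e∈
      with eq ← maxLabel-enumerated enum link =
      w , (∈-elements⁻ (∈-resp-↭ enum (here refl)) , sym eq) , λ u∈ fu≡ →
        only (∈-resp-↭ (↭-sym enum) (∈-elements⁺ u∈)) (trans fu≡ eq)
      where
      only : ∀ {u} → u ∈ w ∷ tabulate v → f u ≡ f w → u ≡ w
      only (here u≡w) _ = u≡w
      only (there u∈) fu≡fw with i , refl ← ∈-tabulate⁻ u∈ =
        contradiction fu≡fw (<⇒≢ (layering.descends link i))

    sameMax : ∀ {e e′} → e ∈ edges F → e′ ∈ edges F →
      maxLabel f e ≡ maxLabel f e′ → labels f e ↭ labels f e′
    sameMax e∈ e′∈ eq
      with w , v , enum , link ← enumerated e∈ | w′ , v′ , enum′ , link′ ← enumerated e′∈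
      with fw≡fw′ ← trans (sym (maxLabel-enumerated enum link))
                      (trans eq (maxLabel-enumerated enum′ link′)) =
      ↭-trans (labels-enumerated enum) (↭-trans
        (↭-reflexive (cong₂ _∷_ fw≡fw′
          (List.tabulate-cong (layering.determines link link′ fw≡fw′))))
        (↭-sym (labels-enumerated enum′)))

-- The construction, its freeness and its codegree.

module Construction (j s : ℕ) .{{_ : NonZero j}} .{{_ : NonZero s}} {n : ℕ} where

  -- The lowest `s` base-`s` digits of a vertex number are its labelling, so among `s ^ s * t`
  -- vertices each labelling occurs `t` times.
  tree : Fin n → ℕ → ℕ
  tree x = digit s (toℕ x)

  IsEdge : Subset n → Set
  IsEdge e = Σ[ w ∈ Fin n ] Σ[ v ∈ (Fin j → Fin n) ] Enumerates w v e × Link s (tree w) (tree ∘ v)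

  module _ (isEdge? : ∀ e → Dec (IsEdge e)) where

    H : KGraph (suc j) n
    H = record
      { edges   = filter isEdge? (allSubsets n)
      ; uniform = λ e∈ → let _ , _ , enum , _ = proj₂ (∈-filter⁻ isEdge? {xs = allSubsets n} e∈) in
                  enumerates-∣∣ enum
      ; unique  = Unique.filter⁺ isEdge? (allSubsets-unique n)
      }

    -- An embedding transports the trees to the vertices of `F`, where every edge becomes a link and
    -- `¬¬-layering` applies.
    H-free : ∀ {m} → s ≡ treeSize j m → (F : KGraph (suc j) m) → ¬ Layered F → Free F H
    H-free {m} s≡ F ¬layered (g , g-inj , embeds) = ¬¬-layering (tree ∘ g) λ (f , layering) →
      ¬layered (f , layering⇒layered layering λ e∈ →
        let w , v , enum , link = proj₂ (∈-filter⁻ isEdge? {xs = allSubsets n} (embeds e∈))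
            a , b , enum′ , w≡ , v≡ = enumerates-image⁻ g-inj enum
        in a , b , enum′ , pull w≡ v≡ link)
      where
      pull : ∀ {w v a} {b : Fin j → Fin m} → w ≡ g a → (∀ i → v i ≡ g (b i)) →
        Link s (tree w) (tree ∘ v) → Link (treeSize j m) (tree (g a)) (tree ∘ g ∘ b)
      pull {b = b} refl v≡ link = subst (λ s → Link s (tree (g _)) (tree ∘ g ∘ b)) s≡ record
        { inherits = λ i x x< → trans (Link.inherits link i x x<) (cong (λ u → tree u x) (v≡ i))
        ; fresh    = Link.fresh link
        }

    -- The `t` tops from `link-extension` give distinct edges through `S`; their positions in the
    -- filtered edge list form an injection from `Fin t`.
    degree-≥ : ∀ {t} → n ≡ s ^ s * t → j < s → ∀ S → ∣ S ∣ ≡ j → t ≤ degree H S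
    degree-≥ {t} n≡ j<s S ∣S∣≡j
      with v , v≡ ← as-tabulate (elements S) (trans (length-elements S) ∣S∣≡j)
      with w , w-inj , w< , link ← link-extension s (tree ∘ v) (λ i → digit-< s (toℕ (v i))) =
      Fin.injective⇒≤ {f = λ a → Any.index (W-edge a)} index-inj
      where
      W : Fin t → Fin n
      W a = fromℕ< (subst (w (toℕ a) <_) (sym n≡) (w< (Fin.toℕ<n a)))

      toℕ-W : ∀ a → toℕ (W a) ≡ w (toℕ a)
      toℕ-W a = Fin.toℕ-fromℕ< _

      W-link : ∀ a → Link s (tree (W a)) (tree ∘ v)
      W-link a = subst (λ x → Link s (digit s x) (tree ∘ v)) (sym (toℕ-W a)) (link (toℕ a))

      -- A top equal to some `v i` would carry its own root label at child `i`, against `fresh`; by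
      -- `j < s` that child is a node of the tree.
      W∉S : ∀ a → W a ∉ˢ S
      W∉S a Wa∈S with i , Wa≡vi ← ∈-tabulate⁻ (subst (W a ∈_) (sym v≡) (∈-elements⁺ Wa∈S)) =
        Link.fresh (W-link a) (toℕ i + j * 0) child<s
          (trans (Link.inherits (W-link a) i 0 child<s) (cong (λ u → tree u 0) (sym Wa≡vi)))
        where
        child<s : child i 0 < s
        child<s = <-≤-trans (child-< i z<s) (subst (_< s) (sym (*-identityʳ j)) j<s)

      W-edge : ∀ a → S ∪ ⁅ W a ⁆ ∈ filter (S ⊆?_) (edges H)
      W-edge a = ∈-filter⁺ (S ⊆?_)
        (∈-filter⁺ isEdge? (∈-allSubsets _)
          (W a , v ,
           subst (λ xs → W a ∷ xs ↭ elements (S ∪ ⁅ W a ⁆)) (sym v≡) (elements-∪⁅⁆ (W∉S a)) ,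
           W-link a))
        (p⊆p∪q ⁅ W a ⁆)

      W-injective : ∀ {a a′} → W a ≡ W a′ → a ≡ a′
      W-injective {a} {a′} eq = Fin.toℕ-injective
        (w-inj (trans (sym (toℕ-W a)) (trans (cong toℕ eq) (toℕ-W a′))))

      index-inj : ∀ {a a′} → Any.index (W-edge a) ≡ Any.index (W-edge a′) → a ≡ a′
      index-inj {a} {a′} eq
        with e≡e′ ← Setoid.index-injective (setoid _) (W-edge a) (W-edge a′) eq
        with x∈p∪q⁻ S _ (subst (W a ∈ˢ_) e≡e′ (x∈p∪q⁺ {p = S} (inj₂ (x∈⁅x⁆ (W a)))))
      ... | inj₁ Wa∈S   = contradiction Wa∈S (W∉S a)
      ... | inj₂ Wa∈Wa′ = W-injective (x∈⁅y⁆⇒x≡y _ Wa∈Wa′)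

    minCodegree-≥ : ∀ {t} → n ≡ s ^ s * t → j < s → t ≤ minCodegree H
    -- The default value `n` of the minimum has to be bounded below by `t` as well.
    minCodegree-≥ {t} n≡ j<s = v≤min⁺ (subst (t ≤_) (sym n≡) (m≤n*m t (s ^ s) {{m^n≢0 s s}}))
      (All.map⁺ (All.tabulate λ {S} S∈ →
        degree-≥ n≡ j<s S (proj₂ (∈-filter⁻ (λ S → ∣ S ∣ ≟ j) {xs = allSubsets n} S∈))))

-- Lower bounds for limits.

p-[p-q]≡q : ∀ p q → p ℚ.- (p ℚ.- q) ≡ q
p-[p-q]≡q p q = begin
  p ℚ.- (p ℚ.- q)             ≡⟨ cong (p ℚ.+_) (ℚ.neg-distrib-+ p (ℚ.- q)) ⟩
  p ℚ.+ (ℚ.- p ℚ.+ ℚ.- ℚ.- q) ≡⟨ ℚ.+-assoc p (ℚ.- p) _ ⟨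
  p ℚ.- p ℚ.+ ℚ.- ℚ.- q       ≡⟨ cong₂ ℚ._+_ (ℚ.+-inverseʳ p) (⁻¹-involutive q) ⟩
  0ℚ ℚ.+ q                    ≡⟨ ℚ.+-identityˡ q ⟩
  q                           ∎
  where
  open ≡-Reasoning

p<q⇒0<q-p : ∀ {p q} → p <ℚ q → 0ℚ <ℚ q ℚ.- p
p<q⇒0<q-p {p} {q} p<q = subst (_<ℚ q ℚ.- p) (ℚ.+-inverseʳ p) (ℚ.+-monoˡ-< (ℚ.- p) p<q)

lower-resp-≤ : ∀ (x : ℝ) {p r} → p ≤ℚ r → Lower x r → Lower x p
lower-resp-≤ x p≤r r< with r′ , r<r′ , r′< ← Equivalence.to (lower-round x) r< =
  Equivalence.from (lower-round x) (r′ , ℚ.≤-<-trans p≤r r<r′ , r′<)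

-- If `x < p`, choose `p′` with `x < p′ < p` and take `p - p′` as the tolerance: a late term with
-- `p ≤ a n` then forces `p′ < x`.
limit-≥ : ∀ {a : ∀ n → .{{NonZero n}} → ℚ} (x : ℝ) p → a ⟶ x →
  (∀ N → ¬ ¬ (Σ[ n ∈ ℕ ] Σ[ n≢0 ∈ NonZero n ] N ≤ n × p ≤ℚ a n {{n≢0}})) → p ≤ℝ x
limit-≥ {a} x p a⟶x frequently x<p
  with p′ , p′<p , x<p′ ← Equivalence.to (upper-round x) x<p
  with N , close ← a⟶x (p ℚ.- p′) (p<q⇒0<q-p p′<p) =
  frequently N λ (n , n≢0 , N≤n , p≤an) →
    disjoint x (lower-resp-≤ x
      (subst (_≤ℚ a n {{n≢0}} ℚ.- (p ℚ.- p′)) (p-[p-q]≡q p p′) (ℚ.+-monoˡ-≤ (ℚ.- (p ℚ.- p′)) p≤an))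
      (proj₁ (close n {{n≢0}} N≤n)) , x<p′)

fromℚᵘ-mono-≤ : ∀ {p q} → p ℚᵘ.≤ q → ℚ.fromℚᵘ p ≤ℚ ℚ.fromℚᵘ q
fromℚᵘ-mono-≤ {p} {q} p≤q = ℚ.toℚᵘ-cancel-≤
  (ℚᵘ.≤-respˡ-≃ (ℚᵘ.≃-sym (ℚ.toℚᵘ-fromℚᵘ p)) (ℚᵘ.≤-respʳ-≃ (ℚᵘ.≃-sym (ℚ.toℚᵘ-fromℚᵘ q)) p≤q))

1/Q≤d/n : ∀ Q d n .{{_ : NonZero Q}} .{{_ : NonZero n}} → n ≤ Q * d → + 1 ℚ./ Q ≤ℚ + d ℚ./ n
1/Q≤d/n Q@(suc Q-1) d n@(suc n-1) n≤Qd = fromℚᵘ-mono-≤ {mkℚᵘ (+ 1) Q-1} {mkℚᵘ (+ d) n-1} (ℚᵘ.*≤*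
  (subst₂ ℤ._≤_ (ℤ.pos-* 1 n) (ℤ.pos-* d Q)
    (ℤ.+≤+ (subst₂ _≤_ (sym (*-identityˡ n)) (*-comm Q d) n≤Qd))))

-- Tree sizes and the final estimate.

treeSize-closed : ∀ d m → treeSize (suc d) m * d ≡ suc d ^ (m + 1) ∸ 1
treeSize-closed d m = trans (cong (_∸ 1) (suc-treeSize m))
  (cong (λ l → suc d ^ l ∸ 1) (+-comm 1 m))
  where
  open ≡-Reasoning
  -- Adding one to both sides of the geometric sum avoids truncated subtraction in the induction.
  suc-treeSize : ∀ m → suc (treeSize (suc d) m * d) ≡ suc d ^ suc m
  suc-treeSize zero    = cong suc (trans (*-identityˡ d) (sym (*-identityʳ d)))
  suc-treeSize (suc m) = begin
    suc d + suc d * s * d   ≡⟨ cong (λ x → suc d + x) (*-assoc (suc d) s d) ⟩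
    suc d + suc d * (s * d) ≡⟨ *-suc (suc d) (s * d) ⟨
    suc d * suc (s * d)     ≡⟨ cong (suc d *_) (suc-treeSize m) ⟩
    suc d ^ suc (suc m)     ∎
    where s = treeSize (suc d) m

q≡treeSize : ∀ d m k≥3 → q (suc (suc (suc d))) m k≥3 ≡ treeSize (suc (suc d)) m
q≡treeSize d m k≥3 = *-cancelʳ-≡ _ _ (suc d)
  (trans (q-exact (suc (suc (suc d))) m k≥3) (sym (treeSize-closed (suc d) m)))

turán-number-≥ : ∀ {j m} .{{_ : NonZero j}} (F : KGraph (suc j) (suc m)) → ¬ Layered F →
  ∀ s .{{_ : NonZero s}} → s ≡ treeSize j (suc m) →
  ∀ {t d} → IsCodegreeTuranNumber F (s ^ s * t) d → ¬ ¬ (t ≤ d)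
turán-number-≥ {j} {m} F ¬layered s s≡ {t} (_ , maximal) t≰d =
  ¬¬-decidable IsEdge λ isEdge? → t≰d
    (≤-trans (minCodegree-≥ isEdge? refl j<s)
             (maximal (H isEdge?) (H-free isEdge? s≡ F ¬layered)))
  where
  open Construction j s
  j<s : j < s
  j<s = subst (j <_) (sym s≡) (s≤s (m≤m*n j (treeSize j m) {{>-nonZero (0<treeSize j m)}}))

-- With no vertices the tree is a bare root and `j < s` may fail, so this case is settled directly.
edgeless-layered : ∀ {k} (F : KGraph (suc k) 0) → Layered F
edgeless-layered F = (λ ()) , record
  { uniqueMax = λ e∈ → contradiction e∈ no-edge
  ; sameMax   = λ e∈ → contradiction e∈ no-edge
  }
  where
  no-edge : ∀ {e} → ¬ e ∈ edges F
  no-edge {Vec.[]} e∈ with () ← uniform F e∈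

theorem2 : (k m : ℕ) (k≥3 : 3 ≤ k) (F : KGraph k m) → ¬ Layered F →
    (π : ℝ) → IsCodegreeTuranDensity F π →
    (q^-q k m k≥3 ≤ℝ π) × (0ℚ <ℚ q^-q k m k≥3)
theorem2 k zero (s≤s _) F ¬layered π _ = contradiction (edgeless-layered F) ¬layered
theorem2 k@(suc (suc (suc d))) m@(suc _) k≥3@(s≤s (s≤s (s≤s z≤n))) F ¬layered π
         (ex , turán , ex/n⟶π) =
  limit-≥ π (q^-q k m k≥3) ex/n⟶π frequently ,
  ℚ.positive⁻¹ _ {{ℚ.normalize-pos 1 (s ^ s)}}
  where
  s = q k m k≥3
  instance
    s≢0 : NonZero s
    s≢0 = q-nonZero k m k≥3
    s^s≢0 : NonZero (s ^ s)
    s^s≢0 = m^n≢0 s s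

  frequently : ∀ N → ¬ ¬ (Σ[ n ∈ ℕ ] Σ[ n≢0 ∈ NonZero n ]
    N ≤ n × q^-q k m k≥3 ≤ℚ ℚ._/_ (+ ex n) n {{n≢0}})
  frequently N none =
    turán-number-≥ F ¬layered s (q≡treeSize d m k≥3) (turán n) λ N<ex →
      none (n , n≢0 , ≤-trans (n≤1+n N) (m≤n*m (suc N) (s ^ s)) ,
        1/Q≤d/n (s ^ s) (ex n) n {{s^s≢0}} {{n≢0}} (*-monoʳ-≤ (s ^ s) N<ex))
    where
    -- A multiple of `s ^ s`, as the codegree bound demands; `suc N` keeps it positive even for
    -- `N = 0`.
    n = s ^ s * suc N
    n≢0 : NonZero n
    n≢0 = m*n≢0 (s ^ s) (suc N)
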